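{- Let $A$ be a finite set with $q:=|A|\ge 2$ and let $n\ge 2$ be an integer. (a) Unless $q=n=2$, the symmetric group $\mathrm{Sym}(A^n)$ is generated by $n$ instructions. (b) If $q\ge 3$, then the alternating group $\mathrm{Alt}(A^n)$ is generated by $n$ instructions (i.e. there exist $n$ instructions, each an even permutation of $A^n$, which generate $\mathrm{Alt}(A^n)$).
   Context: Elements of $A^n$ are written $x=(x_1,\ldots,x_n)$. Any $f\in\mathrm{Sym}(A^n)$ is written $f(x)=(f_1(x),\ldots,f_n(x))$ with coordinate functions $f_i:A^n\to A$; the $i$-th coordinate function is trivial if $f_i(x)=x_i$ for all $x$. An instruction is a permutation $g$ of $A^n$ with at most one nontrivial coordinate function, i.e. $g(x)=(x_1,\ldots,x_{j-1},g_j(x),x_{j+1},\ldots,x_n)$ for some $j$ (it is said to update register $j$); by convention the identity is also an instruction. -}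

module Defs where

open import Algebra.Bundles using (Group)
open import Data.Fin using (Fin)
open import Data.List using (foldr; length)
open import Data.List.Relation.Unary.All using (All)
open import Data.Nat using (ℕ)
open import Data.Nat.Divisibility using (_∣_)
open import Data.Product using (_×_; _,_; ∃-syntax)
open import Data.Vec using (Vec; lookup)
open import Function using (_↔_; _⇔_; Inverse)
open import Function.Construct.Composition using (_↔-∘_)
open import Function.Construct.Identity using (↔-id)
open import Function.Construct.Symmetry using (↔-sym)
open import Level using (0ℓ)
open import Relation.Binary.PropositionalEquality using (_≡_; _≢_; refl; sym; trans; cong)
open import Relation.Unary using (Pred; _∈_)

open Inverse using (to; from; strictlyInverseˡ; strictlyInverseʳ)

-- Permutations are compared pointwise, since there is no function
-- extensionality.  The product is composition of functions:
-- to (f ∙ g) x = to f (to g x).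
Sym : Set → Group 0ℓ 0ℓ
Sym X = record
  { Carrier = X ↔ X
  ; _≈_     = λ f g → ∀ x → to f x ≡ to g x
  ; _∙_     = λ f g → f ↔-∘ g
  ; ε       = ↔-id X
  ; _⁻¹     = ↔-sym
  ; isGroup = record
    { isMonoid = record
      { isSemigroup = record
        { isMagma = record
          { isEquivalence = record
            { refl  = λ _ → refl
            ; sym   = λ f≈g x → sym (f≈g x)
            ; trans = λ f≈g g≈h x → trans (f≈g x) (g≈h x)
            }
          ; ∙-cong = λ {f} {_} {_} {k} f≈g h≈k x →
              trans (cong (to f) (h≈k x)) (f≈g (to k x))
          }
        ; assoc = λ _ _ _ _ → refl
        }
      ; identity = (λ _ _ → refl) , (λ _ _ → refl)
      }
    ; inverse = strictlyInverseʳ , strictlyInverseˡ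
    ; ⁻¹-cong = λ {f} {g} f≈g x →
        trans (cong (from f) (sym (strictlyInverseˡ g x)))
          (trans (cong (from f) (sym (f≈g (from g x))))
            (strictlyInverseʳ f (from g x)))
    }
  }

module _ (G : Group 0ℓ 0ℓ) where
  open Group G

  data Span {I : Set} (g : I → Carrier) : Pred Carrier 0ℓ where
    gen  : ∀ i → g i ∈ Span g
    unit : ε ∈ Span g
    mul  : ∀ {x y} → x ∈ Span g → y ∈ Span g → x ∙ y ∈ Span g
    inv  : ∀ {x} → x ∈ Span g → x ⁻¹ ∈ Span g
    resp : ∀ {x y} → x ≈ y → x ∈ Span g → y ∈ Span g

  Generates : {I : Set} → (I → Carrier) → Pred Carrier 0ℓ → Set
  Generates g H = ∀ x → x ∈ Span g ⇔ x ∈ H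

module _ {X : Set} where
  open Group (Sym X)

  IsTransposition : Pred (X ↔ X) 0ℓ
  IsTransposition t = ∃[ a ] ∃[ b ]
    (a ≢ b × to t a ≡ b × to t b ≡ a × (∀ x → x ≢ a → x ≢ b → to t x ≡ x))

  IsEven : Pred (X ↔ X) 0ℓ
  IsEven f = ∃[ ts ] (All IsTransposition ts × 2 ∣ length ts × f ≈ foldr _∙_ ε ts)

Alt : (X : Set) → Pred (Group.Carrier (Sym X)) 0ℓ
Alt X = IsEven

module _ {A : Set} {n : ℕ} where

  coordinate : (Vec A n ↔ Vec A n) → Fin n → Vec A n → A
  coordinate f i x = lookup (to f x) i

  Trivial : (Vec A n ↔ Vec A n) → Pred (Fin n) 0ℓ
  Trivial f i = ∀ x → coordinate f i x ≡ lookup x i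

  -- For n ≥ 1 this includes the identity.
  IsInstruction : Pred (Vec A n ↔ Vec A n) 0ℓ
  IsInstruction g = ∃[ j ] (∀ i → i ≢ j → Trivial g i)

{-# OPTIONS --safe #-}

-- Write 0, 1, 2 for three elements of A, u for the zero vector, and call the
-- set of points that differ only in register j a j-line.
--
-- Criterion.  Let G be a permutation group and let x ~ y mean that x = y or
-- that some 3-cycle of G maps x to y.  Conjugating 3-cycles by 3-cycles shows
-- that ~ is a G-invariant equivalence relation.  If each generator maps some
-- point of the class of u into that class, the class is G-invariant; so if
-- moreover G is transitive, there is only one class, G contains every 3-cycle,
-- and hence every even permutation.
--
-- q ≥ 3.  For j ≥ 2 the j-th generator fixes the j-line through u pointwise and
-- acts as one q-cycle on every other j-line; exchanging, if necessary, the
-- values 1 and 2 on the line through u gives it any prescribed parity.  The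
-- first generator acts on registers 1 and 2 only where all other registers
-- are 0: on x₁ it is (0 1 2) if x₂ = 0, (0 1) if x₂ = 1, 2, and (0 1)(2 c) if
-- x₂ = c is another value.  It is even, and its square is a 3-cycle.
--
-- q = 2, n ≥ 3.  The first generator is the transposition of u and
-- v = (1,0,…,0).  The second flips x₂ except on the line through v, the others
-- flip x_j except on the line through u.  The first generator and its conjugate
-- by the second are transpositions with one common point, so their product is
-- a 3-cycle.
module Submission where

open import Defs
open import Algebra.Bundles using (Group)
open import Data.Fin using (Fin; zero; suc; fromℕ; inject₁)
open import Data.Fin.Properties using () renaming (_≟_ to _≟ᶠ_)
open import Data.Fin.Relation.Unary.Top using (view; view-fromℕ; view-inject₁; ‵fromℕ; ‵inject₁)
open import Data.List using (List; []; _∷_; _++_; foldr; length; map; allFin; cartesianProductWith)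
open import Data.List.Membership.Propositional using () renaming (_∈_ to _∈ₗ_; _∉_ to _∉ₗ_)
open import Data.List.Membership.Propositional.Properties using (∈-map⁺; ∈-allFin; ∈-cartesianProductWith⁺)
open import Data.List.Properties using (length-++)
open import Data.List.Relation.Unary.All using (All; []; _∷_)
open import Data.List.Relation.Unary.All.Properties using (++⁺)
open import Data.List.Relation.Unary.Any using (here; there)
open import Data.Nat using (ℕ; zero; suc; _≤_; s≤s)
open import Data.Nat.Divisibility using (_∣_; ∣m∣n⇒∣m+n; ∣m+n∣m⇒∣n; ∣-refl; _∣0; ∣1⇒≡1)
open import Data.Nat.Properties using (+-suc; +-comm)
open import Data.Product using (_×_; _,_; ∃-syntax; proj₁; proj₂)
open import Data.Sum using (_⊎_; inj₁; inj₂; [_,_]′)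
open import Data.Unit using (tt)
open import Data.Vec using (Vec; []; _∷_; lookup; removeAt; replicate; _[_]≔_)
open import Data.Vec.Properties using (≡-dec; ∷-injectiveˡ; ∷-injectiveʳ; []≔-idempotent; []≔-lookup; lookup∘update; lookup∘update′; lookup-replicate)
open import Function using (_↔_; Inverse; mk↔ₛ′; mk⇔; _∘_)
open import Function.Construct.Composition using (_↔-∘_)
open import Function.Construct.Symmetry using (↔-sym)
open import Function.Properties.Inverse using (Inverse⇒Injection)
open import Level using (0ℓ)
open import Relation.Binary.Definitions using (DecidableEquality)
open import Relation.Binary.PropositionalEquality using (_≡_; _≢_; refl; sym; trans; cong; cong₂; subst; ≢-sym)
open import Relation.Nullary using (Dec; ¬_; yes; no; contradiction)
open import Relation.Nullary.Decidable using (via-injection)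
open import Relation.Unary using (Pred; U; _∈_)

open Inverse using (to; from; strictlyInverseˡ; strictlyInverseʳ)

from-unique : {X Y : Set} (f : X ↔ Y) {x : X} {y : Y} → to f x ≡ y → from f y ≡ x
from-unique f {x} refl = strictlyInverseʳ f x

to-injective : {X Y : Set} (f : X ↔ Y) {x y : X} → to f x ≡ to f y → x ≡ y
to-injective f {y = y} eq = trans (sym (from-unique f eq)) (strictlyInverseʳ f y)

-- Parity, counted by lengths of products of transpositions.

module Parity {X : Set} where
  open Group (Sym X) using (_∙_; ε; _⁻¹; _≈_)

  product : List (X ↔ X) → X ↔ X
  product = foldr _∙_ ε

  product-++ : ∀ ts us → product (ts ++ us) ≈ product ts ∙ product us
  product-++ []       us x = refl
  product-++ (t ∷ ts) us x = cong (to t) (product-++ ts us x)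

  -- Not shown to be disjoint from IsEven, which is never needed.
  IsOdd : Pred (X ↔ X) 0ℓ
  IsOdd f = ∃[ ts ] (All IsTransposition ts × 2 ∣ suc (length ts) × f ≈ product ts)

  transposition⁻¹ : ∀ {t} → t ∈ IsTransposition → t ⁻¹ ∈ IsTransposition
  transposition⁻¹ {t} (a , b , a≢b , ta≡b , tb≡a , fixes) =
    a , b , a≢b , from-unique t tb≡a , from-unique t ta≡b ,
    λ x x≢a x≢b → from-unique t (fixes x x≢a x≢b)

  -- Inverting the factors and reversing their order keeps the length, and hence the parity.
  product⁻¹ : ∀ ts → All IsTransposition ts →
    ∃[ us ] (All IsTransposition us × length us ≡ length ts × (product ts) ⁻¹ ≈ product us)
  product⁻¹ [] [] = [] , [] , refl , λ _ → refl
  product⁻¹ (t ∷ ts) (pt ∷ pts) with product⁻¹ ts pts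
  ... | us , pus , len , eq =
    us ++ t ⁻¹ ∷ [] , ++⁺ pus (transposition⁻¹ {t} pt ∷ []) ,
    trans (length-++ us) (trans (+-comm (length us) 1) (cong suc len)) ,
    λ x → trans (eq (from t x)) (sym (product-++ us (t ⁻¹ ∷ []) x))

  even-ε : ε ∈ IsEven
  even-ε = [] , [] , 2 ∣0 , λ _ → refl

  even-resp : ∀ {f g} → f ≈ g → f ∈ IsEven → g ∈ IsEven
  even-resp f≈g (ts , pts , d , eq) = ts , pts , d , λ x → trans (sym (f≈g x)) (eq x)

  ∙-product : ∀ {f g} ts us → f ≈ product ts → g ≈ product us → f ∙ g ≈ product (ts ++ us)
  ∙-product {f} {g} ts us f≈ g≈ x =
    trans (cong (to f) (g≈ x)) (trans (f≈ (to (product us) x)) (sym (product-++ ts us x)))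

  even∙even : ∀ {f g} → f ∈ IsEven → g ∈ IsEven → f ∙ g ∈ IsEven
  even∙even {f} {g} (ts , pts , d , eq) (us , pus , e , eq′) =
    ts ++ us , ++⁺ pts pus ,
    subst (2 ∣_) (sym (length-++ ts)) (∣m∣n⇒∣m+n d e) ,
    ∙-product {f} {g} ts us eq eq′

  odd∙odd : ∀ {f g} → f ∈ IsOdd → g ∈ IsOdd → f ∙ g ∈ IsEven
  odd∙odd {f} {g} (ts , pts , d , eq) (us , pus , e , eq′) =
    ts ++ us , ++⁺ pts pus ,
    subst (2 ∣_) (sym (length-++ ts))
      -- The two successors add up to a 2 in front of the total length, which is then cancelled.
      (∣m+n∣m⇒∣n (subst (2 ∣_) (cong suc (+-suc (length ts) (length us))) (∣m∣n⇒∣m+n d e)) ∣-refl) ,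
    ∙-product {f} {g} ts us eq eq′

  odd∙even : ∀ {f g} → f ∈ IsOdd → g ∈ IsEven → f ∙ g ∈ IsOdd
  odd∙even {f} {g} (ts , pts , d , eq) (us , pus , e , eq′) =
    ts ++ us , ++⁺ pts pus ,
    subst (2 ∣_) (cong suc (sym (length-++ ts))) (∣m∣n⇒∣m+n d e) ,
    ∙-product {f} {g} ts us eq eq′

  even⁻¹ : ∀ {f} → f ∈ IsEven → f ⁻¹ ∈ IsEven
  even⁻¹ {f} (ts , pts , d , eq) with product⁻¹ ts pts
  ... | us , pus , len , eq′ =
    us , pus , subst (2 ∣_) (sym len) d ,
    λ x → trans (Group.⁻¹-cong (Sym X) {f} {product ts} eq x) (eq′ x)

  transposition-odd : ∀ {t} → t ∈ IsTransposition → t ∈ IsOdd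
  transposition-odd {t} pt = t ∷ [] , pt ∷ [] , ∣-refl , λ _ → refl

  span-even : {I : Set} {g : I → X ↔ X} → (∀ i → g i ∈ IsEven) →
    ∀ {f} → f ∈ Span (Sym X) g → f ∈ IsEven
  span-even ev (gen i)       = ev i
  span-even ev unit          = even-ε
  span-even ev (mul {f} {h} f∈ h∈) = even∙even {f} {h} (span-even ev f∈) (span-even ev h∈)
  span-even ev (inv {f} f∈)  = even⁻¹ {f} (span-even ev f∈)
  span-even ev (resp {f} {h} f≈h f∈) = even-resp {f} {h} f≈h (span-even ev f∈)

even-or-odd : ∀ n → 2 ∣ n ⊎ 2 ∣ suc n
even-or-odd zero = inj₁ (2 ∣0)
even-or-odd (suc n) with even-or-odd n
... | inj₁ d = inj₂ (∣m∣n⇒∣m+n ∣-refl d)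
... | inj₂ d = inj₁ d

-- Transpositions, 3-cycles and factorisation over a decidable set.

module Swap {X : Set} (_≟_ : DecidableEquality X) where
  open Group (Sym X) using (_∙_; ε; _⁻¹; _≈_)
  open Parity {X}

  swapFun : X → X → X → X
  swapFun a b x with x ≟ a
  ... | yes _ = b
  ... | no  _ with x ≟ b
  ...   | yes _ = a
  ...   | no  _ = x

  swapFun-left : ∀ a b → swapFun a b a ≡ b
  swapFun-left a b with a ≟ a
  ... | yes _ = refl
  ... | no ¬p = contradiction refl ¬p

  swapFun-right : ∀ a b → swapFun a b b ≡ a
  swapFun-right a b with b ≟ a
  ... | yes b≡a = b≡a
  ... | no  _ with b ≟ b
  ...   | yes _ = refl
  ...   | no ¬p = contradiction refl ¬p

  swapFun-other : ∀ {a b x} → x ≢ a → x ≢ b → swapFun a b x ≡ x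
  swapFun-other {a} {b} {x} x≢a x≢b with x ≟ a
  ... | yes p = contradiction p x≢a
  ... | no  _ with x ≟ b
  ...   | yes p = contradiction p x≢b
  ...   | no  _ = refl

  swapFun-involutive : ∀ a b x → swapFun a b (swapFun a b x) ≡ x
  swapFun-involutive a b x with x ≟ a
  ... | yes refl = swapFun-right a b
  ... | no x≢a with x ≟ b
  ...   | yes refl = swapFun-left a b
  ...   | no x≢b   = swapFun-other x≢a x≢b

  swap : X → X → X ↔ X
  swap a b = mk↔ₛ′ (swapFun a b) (swapFun a b) (swapFun-involutive a b) (swapFun-involutive a b)

  swap-transposition : ∀ {a b} → a ≢ b → swap a b ∈ IsTransposition
  swap-transposition {a} {b} a≢b =
    a , b , a≢b , swapFun-left a b , swapFun-right a b , λ _ → swapFun-other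

  -- Its two points determine a transposition, so membership in a group need only be checked for
  -- `swap`.
  transposition≈swap : ∀ {t} (p : t ∈ IsTransposition) → t ≈ swap (proj₁ p) (proj₁ (proj₂ p))
  transposition≈swap (a , b , _ , ta≡b , tb≡a , fixes) x with x ≟ a
  ... | yes refl = ta≡b
  ... | no x≢a with x ≟ b
  ...   | yes refl = tb≡a
  ...   | no x≢b   = fixes x x≢a x≢b

  swap-comm : ∀ {a b} → a ≢ b → swap a b ≈ swap b a
  swap-comm {a} {b} a≢b = transposition≈swap {swap a b}
    (b , a , ≢-sym a≢b , swapFun-right a b , swapFun-left a b , λ _ x≢b x≢a → swapFun-other x≢a x≢b)

  conjugate-swap : ∀ (h : X ↔ X) a b → h ∙ (swap a b ∙ h ⁻¹) ≈ swap (to h a) (to h b)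
  conjugate-swap h a b x with x ≟ to h a
  ... | yes refl rewrite strictlyInverseʳ h a = cong (to h) (swapFun-left a b)
  ... | no x≢ha with x ≟ to h b
  ...   | yes refl rewrite strictlyInverseʳ h b = cong (to h) (swapFun-right a b)
  ...   | no x≢hb  = trans
    (cong (to h) (swapFun-other
      (λ eq → x≢ha (trans (sym (strictlyInverseˡ h x)) (cong (to h) eq)))
      (λ eq → x≢hb (trans (sym (strictlyInverseˡ h x)) (cong (to h) eq)))))
    (strictlyInverseˡ h x)

  -- Composition acts from the right, so for distinct points this is `a` ↦ `b` ↦ `c` ↦ `a`.
  cycle₃ : X → X → X → X ↔ X
  cycle₃ a b c = swap a b ∙ swap b c

  cycle₃-1 : ∀ {a b c} → a ≢ b → c ≢ a → to (cycle₃ a b c) a ≡ b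
  cycle₃-1 {a} {b} a≢b c≢a = trans (cong (swapFun a b) (swapFun-other a≢b (≢-sym c≢a))) (swapFun-left a b)

  cycle₃-2 : ∀ {a b c} → b ≢ c → c ≢ a → to (cycle₃ a b c) b ≡ c
  cycle₃-2 {a} {b} {c} b≢c c≢a =
    trans (cong (swapFun a b) (swapFun-left b c)) (swapFun-other c≢a (≢-sym b≢c))

  cycle₃-3 : ∀ a b c → to (cycle₃ a b c) c ≡ a
  cycle₃-3 a b c = trans (cong (swapFun a b) (swapFun-right b c)) (swapFun-right a b)

  cycle₃-other : ∀ {a b c x} → x ≢ a → x ≢ b → x ≢ c → to (cycle₃ a b c) x ≡ x
  cycle₃-other {a} {b} x≢a x≢b x≢c =
    trans (cong (swapFun a b) (swapFun-other x≢b x≢c)) (swapFun-other x≢a x≢b)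

  -- Induction on a list containing the support. If `f` moves the head `a`, then following `f` by
  -- the swap of `a` and `f a` fixes `a` and creates no moved point outside the list, so the tail
  -- contains the new support.
  decompose-on : ∀ (L : List X) (f : X ↔ X) → (∀ x → x ∉ₗ L → to f x ≡ x) →
    ∃[ ts ] (All IsTransposition ts × f ≈ product ts)
  decompose-on [] f fixes = [] , [] , λ x → fixes x λ ()
  decompose-on (a ∷ L) f fixes with to f a ≟ a
  ... | yes fa≡a = decompose-on L f fixes′
    where
    fixes′ : ∀ x → x ∉ₗ L → to f x ≡ x
    fixes′ x x∉L with x ≟ a
    ... | yes refl = fa≡a
    ... | no x≢a   = fixes x λ { (here x≡a) → x≢a x≡a ; (there x∈L) → x∉L x∈L }
  ... | no fa≢a = prepend (decompose-on L (swap a b ∙ f) fixes′)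
    where
    b = to f a
    fixes′ : ∀ x → x ∉ₗ L → swapFun a b (to f x) ≡ x
    fixes′ x x∉L with x ≟ a
    ... | yes refl = swapFun-right a b
    ... | no x≢a   = trans (cong (swapFun a b) fx≡x) (swapFun-other x≢a x≢b)
      where
      fx≡x : to f x ≡ x
      fx≡x = fixes x λ { (here x≡a) → x≢a x≡a ; (there x∈L) → x∉L x∈L }
      x≢b : x ≢ b
      -- A fixed point equal to the image of `a` would be `a` itself.
      x≢b x≡b = x≢a (to-injective f (trans fx≡x x≡b))
    prepend : ∃[ ts ] (All IsTransposition ts × swap a b ∙ f ≈ product ts) →
      ∃[ ts ] (All IsTransposition ts × f ≈ product ts)
    prepend (ts , pts , eq) =
      swap a b ∷ ts , swap-transposition (≢-sym fa≢a) ∷ pts ,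
      λ x → trans (sym (swapFun-involutive a b (to f x))) (cong (swapFun a b) (eq x))

  module _ (L : List X) (complete : ∀ x → x ∈ₗ L) where

    decompose : ∀ f → ∃[ ts ] (All IsTransposition ts × f ≈ product ts)
    decompose f = decompose-on L f λ x x∉L → contradiction (complete x) x∉L

    parity : ∀ f → f ∈ IsEven ⊎ f ∈ IsOdd
    parity f with decompose f
    ... | ts , pts , eq with even-or-odd (length ts)
    ...   | inj₁ d = inj₁ (ts , pts , d , eq)
    ...   | inj₂ d = inj₂ (ts , pts , d , eq)

    square-even : ∀ f → f ∙ f ∈ IsEven
    square-even f with parity f
    ... | inj₁ ev = even∙even {f} {f} ev ev
    ... | inj₂ od = odd∙odd {f} {f} od od

  -- The 3-cycle criterion.

  module Criterion {I : Set} (g : I → X ↔ X) where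

    𝓖 : Pred (X ↔ X) 0ℓ
    𝓖 = Span (Sym X) g

    -- Witnesses that the 3-cycle a ↦ b ↦ c ↦ a lies in 𝓖.
    record T (a b c : X) : Set where
      constructor mkT
      field
        a≢b   : a ≢ b
        b≢c   : b ≢ c
        c≢a   : c ≢ a
        perm  : X ↔ X
        perm∈ : perm ∈ 𝓖
        ab    : to perm a ≡ b
        bc    : to perm b ≡ c
        ca    : to perm c ≡ a
        fixes : ∀ x → x ≢ a → x ≢ b → x ≢ c → to perm x ≡ x

    T-rotate : ∀ {a b c} → T a b c → T b c a
    T-rotate (mkT a≢b b≢c c≢a f f∈ ab bc ca fixes) =
      mkT b≢c c≢a a≢b f f∈ bc ca ab λ x x≢b x≢c x≢a → fixes x x≢a x≢b x≢c

    T-reverse : ∀ {a b c} → T a b c → T c b a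
    T-reverse (mkT a≢b b≢c c≢a f f∈ ab bc ca fixes) =
      mkT (≢-sym b≢c) (≢-sym a≢b) (≢-sym c≢a) (f ⁻¹) (inv f∈)
        (from-unique f bc) (from-unique f ab) (from-unique f ca)
        λ x x≢c x≢b x≢a → from-unique f (fixes x x≢a x≢b x≢c)

    T-conjugate : ∀ {h a b c} → h ∈ 𝓖 → T a b c → T (to h a) (to h b) (to h c)
    T-conjugate {h} {a} {b} {c} h∈ (mkT a≢b b≢c c≢a f f∈ ab bc ca fixes) =
      mkT (a≢b ∘ to-injective h) (b≢c ∘ to-injective h) (c≢a ∘ to-injective h)
        (h ∙ (f ∙ h ⁻¹)) (mul h∈ (mul f∈ (inv h∈)))
        (moves ab) (moves bc) (moves ca)
        λ x x≢ha x≢hb x≢hc → trans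
          (cong (to h) (fixes (from h x) (pull x≢ha) (pull x≢hb) (pull x≢hc)))
          (strictlyInverseˡ h x)
      where
      moves : ∀ {x y} → to f x ≡ y → to h (to f (from h (to h x))) ≡ to h y
      moves {x} eq = cong (to h) (trans (cong (to f) (strictlyInverseʳ h x)) eq)
      pull : ∀ {x y} → x ≢ to h y → from h x ≢ y
      pull {x} x≢hy eq = x≢hy (trans (sym (strictlyInverseˡ h x)) (cong (to h) eq))

    T-conjugate′ : ∀ {h a b c a′ b′ c′} → h ∈ 𝓖 → T a b c →
      to h a ≡ a′ → to h b ≡ b′ → to h c ≡ c′ → T a′ b′ c′
    T-conjugate′ h∈ t refl refl refl = T-conjugate h∈ t

    infix 4 _~_
    _~_ : X → X → Set
    a ~ b = a ≡ b ⊎ ∃[ c ] T a b c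

    ~-sym : ∀ {a b} → a ~ b → b ~ a
    ~-sym (inj₁ eq)      = inj₁ (sym eq)
    ~-sym (inj₂ (c , t)) = inj₂ (c , T-rotate (T-reverse t))

    -- Conjugating the second 3-cycle by the inverse of the first moves `b` to `a` and fixes `c`,
    -- unless `c` already lies on the first; in that case the reversed first cycle maps `a` to `c`.
    ~-trans : ∀ {a b c} → a ~ b → b ~ c → a ~ c
    ~-trans (inj₁ refl) q = q
    ~-trans p@(inj₂ _) (inj₁ refl) = p
    ~-trans {a} {b} {c} (inj₂ (d , t)) (inj₂ (e , s)) with a ≟ c | c ≟ d
    ... | yes a≡c | _        = inj₁ a≡c
    ... | no a≢c  | yes refl = inj₂ (b , T-rotate (T-rotate (T-reverse t)))
    ... | no a≢c  | no c≢d   =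
      inj₂ (_ , T-conjugate′ (inv t.perm∈) s (from-unique t.perm t.ab)
        (from-unique t.perm (t.fixes c (≢-sym a≢c) (≢-sym s.a≢b) c≢d)) refl)
      where
      module t = T t
      module s = T s

    ~-map : ∀ {h a b} → h ∈ 𝓖 → a ~ b → to h a ~ to h b
    ~-map {h} h∈ (inj₁ refl)    = inj₁ refl
    ~-map {h} h∈ (inj₂ (c , t)) = inj₂ (to h c , T-conjugate h∈ t)

    infix 4 _⇝_
    _⇝_ : X → X → Set
    x ⇝ y = ∃[ h ] (h ∈ 𝓖 × to h x ≡ y)

    ⇝-reflexive : ∀ {x y} → x ≡ y → x ⇝ y
    ⇝-reflexive eq = ε , unit , eq

    ⇝-sym : ∀ {x y} → x ⇝ y → y ⇝ x
    ⇝-sym (h , h∈ , eq) = h ⁻¹ , inv h∈ , from-unique h eq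

    ⇝-trans : ∀ {x y w} → x ⇝ y → y ⇝ w → x ⇝ w
    ⇝-trans (h , h∈ , eq) (k , k∈ , eq′) = k ∙ h , mul k∈ h∈ , trans (cong (to k) eq) eq′

    module _ {u : X} (stable : ∀ i → ∃[ a ] (a ~ u × to (g i) a ~ u)) where

      -- Elements of the group permute the classes of `~`, so one point of the class of `u` that
      -- stays in it keeps the whole class in place; this passes to products and inverses.
      block-stable : ∀ {h} → h ∈ 𝓖 → to h u ~ u
      block-stable (gen i) with stable i
      ... | a , a~u , ga~u = ~-trans (~-map (gen i) (~-sym a~u)) ga~u
      block-stable unit = inj₁ refl
      block-stable (mul h∈ k∈) = ~-trans (~-map h∈ (block-stable k∈)) (block-stable h∈)
      block-stable (inv {h} h∈) =
        subst (from h u ~_) (strictlyInverseʳ h u) (~-map (inv h∈) (~-sym (block-stable h∈)))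
      block-stable (resp h≈k h∈) = subst (_~ u) (h≈k u) (block-stable h∈)

      module _ (transitive : ∀ x → u ⇝ x) where

        all~ : ∀ x y → x ~ y
        all~ x y with transitive x | transitive y
        ... | h , h∈ , refl | k , k∈ , refl = ~-trans (block-stable h∈) (~-sym (block-stable k∈))

        -- From `a ~ b` comes a 3-cycle with some third point `d`, and from `d ~ c` a 3-cycle `d` ↦
        -- `c` ↦ `e`. If `e` is neither `a` nor `b`, conjugating the first by the second replaces
        -- `d` by `c` and fixes the rest.
        all-T : ∀ {a b c} → a ≢ b → b ≢ c → c ≢ a → T a b c
        all-T {a} {b} {c} a≢b b≢c c≢a with all~ a b
        ... | inj₁ a≡b = contradiction a≡b a≢b
        ... | inj₂ (d , t) with all~ d c
        ...   | inj₁ refl = t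
        ...   | inj₂ (e , s) = move (e ≟ a) (e ≟ b)
          where
          module t = T t
          module s = T s
          move : _ → _ → T a b c
          -- When `e` is `a` or `b`, the inverse of the second cycle carries the three points onto
          -- `a`, `b`, `c` with the opposite orientation, hence the reversal.
          move (yes refl) _ = T-reverse (T-conjugate′ (inv s.perm∈) t
            (from-unique s.perm s.bc)
            (from-unique s.perm (s.fixes b t.b≢c b≢c (≢-sym a≢b)))
            (from-unique s.perm s.ca))
          move (no _) (yes refl) = T-rotate (T-rotate (T-reverse (T-conjugate′ (inv s.perm∈) t
            (from-unique s.perm (s.fixes a (≢-sym t.c≢a) (≢-sym c≢a) a≢b))
            (from-unique s.perm s.bc)
            (from-unique s.perm s.ca))))
          move (no e≢a) (no e≢b) = T-conjugate′ s.perm∈ t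
            (s.fixes a (≢-sym t.c≢a) (≢-sym c≢a) (≢-sym e≢a))
            (s.fixes b t.b≢c b≢c (≢-sym e≢b))
            s.ab

        -- Two swaps with the common point `b` compose to a 3-cycle, or to the identity if they
        -- coincide.
        swap∙swap∈ : ∀ {a b c} → a ≢ b → b ≢ c → swap a b ∙ swap b c ∈ 𝓖
        swap∙swap∈ {a} {b} {c} a≢b b≢c with a ≟ c
        ... | yes refl = resp
          (λ x → sym (trans (cong (swapFun a b) (swap-comm (≢-sym a≢b) x)) (swapFun-involutive a b x))) unit
        ... | no a≢c = resp same t.perm∈
          where
          module t = T (all-T a≢b b≢c (≢-sym a≢c))
          same : ∀ x → to t.perm x ≡ to (cycle₃ a b c) x
          same x = compare (x ≟ a) (x ≟ b) (x ≟ c)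
            where
            compare : Dec (x ≡ a) → Dec (x ≡ b) → Dec (x ≡ c) → to t.perm x ≡ to (cycle₃ a b c) x
            compare (yes refl) _ _ = trans t.ab (sym (cycle₃-1 a≢b (≢-sym a≢c)))
            compare (no _) (yes refl) _ = trans t.bc (sym (cycle₃-2 b≢c (≢-sym a≢c)))
            compare (no _) (no _) (yes refl) = trans t.ca (sym (cycle₃-3 a b c))
            compare (no x≢a) (no x≢b) (no x≢c) = trans (t.fixes x x≢a x≢b x≢c) (sym (cycle₃-other x≢a x≢b x≢c))

        pair∈ : ∀ {a b c d} → a ≢ b → c ≢ d → swap a b ∙ swap c d ∈ 𝓖
        pair∈ {a} {b} {c} {d} a≢b c≢d with b ≟ c
        ... | yes refl = swap∙swap∈ a≢b c≢d
        -- The factor `swap b c` is inserted twice, which splits the product into two pairs with a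
        -- common point.
        ... | no b≢c   = resp (λ x → cong (swapFun a b) (swapFun-involutive b c (swapFun c d x)))
                              (mul (swap∙swap∈ a≢b b≢c) (swap∙swap∈ b≢c c≢d))

        product∈ : ∀ ts → All IsTransposition ts → 2 ∣ length ts → product ts ∈ 𝓖
        product∈ [] [] _ = unit
        product∈ (_ ∷ []) _ d with ∣1⇒≡1 d
        ... | ()
        product∈ (t ∷ s ∷ ts) (pt@(a , b , a≢b , _) ∷ ps@(c , d , c≢d , _) ∷ pts) div =
          resp same (mul (pair∈ a≢b c≢d) (product∈ ts pts (∣m+n∣m⇒∣n div ∣-refl)))
          where
          same : (swap a b ∙ swap c d) ∙ product ts ≈ product (t ∷ s ∷ ts)
          same x = trans
            (sym (transposition≈swap {t} pt (swapFun c d (to (product ts) x))))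
            (cong (to t) (sym (transposition≈swap {s} ps (to (product ts) x))))

        even⊆ : ∀ f → f ∈ IsEven → f ∈ 𝓖
        even⊆ f (ts , pts , d , eq) = resp (λ x → sym (eq x)) (product∈ ts pts d)

        -- For odd `f` the product `o ∙ f` is even, and `o` can be cancelled inside the group.
        all⊆ : (∀ f → f ∈ IsEven ⊎ f ∈ IsOdd) → ∀ {o} → o ∈ 𝓖 → o ∈ IsOdd → ∀ f → f ∈ 𝓖
        all⊆ par {o} o∈ odd f with par f
        ... | inj₁ ev = even⊆ f ev
        ... | inj₂ od = resp (λ x → strictlyInverseʳ o (to f x))
                             (mul (inv o∈) (even⊆ (o ∙ f) (odd∙odd {o} {f} odd od)))

-- Swaps under injections, updates of vectors, and instructions.

module _ {A X : Set} (_≟₁_ : DecidableEquality A) (_≟₂_ : DecidableEquality X) where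

  swapFun-natural : (φ : A → X) → (∀ {x y} → φ x ≡ φ y → x ≡ y) →
    ∀ a b x → Swap.swapFun _≟₂_ (φ a) (φ b) (φ x) ≡ φ (Swap.swapFun _≟₁_ a b x)
  swapFun-natural φ injective a b x with x ≟₁ a
  ... | yes refl = Swap.swapFun-left _≟₂_ (φ x) (φ b)
  ... | no x≢a with x ≟₁ b
  ...   | yes refl = Swap.swapFun-right _≟₂_ (φ a) (φ x)
  ...   | no x≢b   = Swap.swapFun-other _≟₂_ (x≢a ∘ injective) (x≢b ∘ injective)

module _ {A : Set} where

  removeAt-update : ∀ {m} (x : Vec A (suc m)) j a → removeAt (x [ j ]≔ a) j ≡ removeAt x j
  removeAt-update (_ ∷ x)     zero    a = refl
  removeAt-update (b ∷ c ∷ x) (suc zero) a = refl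
  removeAt-update (b ∷ c ∷ x@(_ ∷ _)) (suc (suc j)) a = cong (b ∷_) (removeAt-update (c ∷ x) (suc j) a)

  removeAt-replicate : ∀ m (j : Fin (suc m)) (a : A) → removeAt (replicate (suc m) a) j ≡ replicate m a
  removeAt-replicate m       zero    a = refl
  removeAt-replicate (suc m) (suc j) a = cong (a ∷_) (removeAt-replicate m j a)

  -- The registers are corrected one at a time from the left; the recursion runs on the tails behind
  -- the already corrected head `b`.
  updates-connect : ∀ {m} (R : Vec A m → Vec A m → Set) → (∀ {x} → R x x) →
    (∀ {x y w} → R x y → R y w → R x w) → (∀ x j a → R x (x [ j ]≔ a)) → ∀ x y → R x y
  updates-connect R R-refl R-trans update []      []      = R-refl
  updates-connect R R-refl R-trans update (a ∷ x) (b ∷ y) = R-trans (update (a ∷ x) zero b)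
    (updates-connect (λ x y → R (b ∷ x) (b ∷ y)) R-refl R-trans (λ x j → update (b ∷ x) (suc j)) x y)

  vectors : List A → ∀ n → List (Vec A n)
  vectors L zero    = [] ∷ []
  vectors L (suc n) = cartesianProductWith _∷_ L (vectors L n)

  vectors-complete : ∀ {L} → (∀ a → a ∈ₗ L) → ∀ {n} (x : Vec A n) → x ∈ₗ vectors L n
  vectors-complete complete []      = here refl
  vectors-complete complete (a ∷ x) =
    ∈-cartesianProductWith⁺ _∷_ (complete a) (vectors-complete complete x)

  -- The permutation of register `j` is selected by the other registers alone. These survive the
  -- update, so the inverse selects the same permutation.
  instruction : ∀ {m} → Fin (suc m) → (Vec A m → A ↔ A) → Vec A (suc m) ↔ Vec A (suc m)
  instruction {m} j π = mk↔ₛ′ (apply to) (apply from)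
    (cancel from to λ c → strictlyInverseˡ (π c)) (cancel to from λ c → strictlyInverseʳ (π c))
    where
    apply : (A ↔ A → A → A) → Vec A (suc m) → Vec A (suc m)
    apply d x = x [ j ]≔ d (π (removeAt x j)) (lookup x j)
    cancel : ∀ d e → (∀ c a → e (π c) (d (π c) a) ≡ a) → ∀ x → apply e (apply d x) ≡ x
    cancel d e inverse x
      rewrite removeAt-update x j (d (π (removeAt x j)) (lookup x j))
            | lookup∘update j x (d (π (removeAt x j)) (lookup x j))
            | inverse (removeAt x j) (lookup x j)
      = trans ([]≔-idempotent x j) ([]≔-lookup x j)

  TrivialExcept : ∀ {n} → Fin n → Pred (Vec A n ↔ Vec A n) 0ℓ
  TrivialExcept j f = ∀ i → i ≢ j → Trivial f i

  instruction-trivial : ∀ {m} j π → instruction {m} j π ∈ TrivialExcept j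
  instruction-trivial j π i i≢j x = lookup∘update′ i≢j x _

-- Rotations of the lines in one register.

-- p-induction says that iterating p takes every element to z, i.e. p is transitive.
module Registers {A : Set} (_≟_ : DecidableEquality A) (L : List A) (complete : ∀ a → a ∈ₗ L)
  (z : A) (p : A ↔ A)
  (p-induction : (P : A → Set) → (∀ a → P (to p a) → P a) → P z → ∀ a → P a) where

  _≟ᵥ_ : ∀ {n} → DecidableEquality (Vec A n)
  _≟ᵥ_ = ≡-dec _≟_

  module A = Swap _≟_
  module V {n : ℕ} = Swap (_≟ᵥ_ {n})
  open Parity

  zeros : ∀ n → Vec A n
  zeros n = replicate n z

  parityᵥ : ∀ {n} (f : Vec A n ↔ Vec A n) → f ∈ IsEven ⊎ f ∈ IsOdd
  parityᵥ {n} = V.parity (vectors L n) (vectors-complete complete)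

  swap-trivial : ∀ {n} (x : Vec A n) j a b → V.swap (x [ j ]≔ a) (x [ j ]≔ b) ∈ TrivialExcept j
  swap-trivial x j a b i i≢j y with y ≟ᵥ (x [ j ]≔ a)
  ... | yes refl = trans (lookup∘update′ i≢j x b) (sym (lookup∘update′ i≢j x a))
  ... | no  _ with y ≟ᵥ (x [ j ]≔ b)
  ...   | yes refl = trans (lookup∘update′ i≢j x a) (sym (lookup∘update′ i≢j x b))
  ...   | no  _    = refl

  module _ {m : ℕ} (j : Fin (suc m)) (c₀ : Vec A m) where

    -- The vector left after removing register `j` names a `j`-line; `c₀` names the one that is not
    -- rotated.
    avoid : Vec A m → A ↔ A
    avoid c with c ≟ᵥ c₀
    ... | yes _ = Group.ε (Sym A)
    ... | no  _ = p

    rotation : Vec A (suc m) ↔ Vec A (suc m)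
    rotation = instruction j avoid

    rotation-trivial : rotation ∈ TrivialExcept j
    rotation-trivial = instruction-trivial j avoid

    rotation-fixes : ∀ x → removeAt x j ≡ c₀ → to rotation x ≡ x
    rotation-fixes x eq with removeAt x j ≟ᵥ c₀
    ... | yes _ = []≔-lookup x j
    ... | no ¬p = contradiction eq ¬p

    -- Silent about the exceptional line, so that it still holds after a rotation is altered there.
    Rotates : Pred (Vec A (suc m) ↔ Vec A (suc m)) 0ℓ
    Rotates f = ∀ x → removeAt x j ≢ c₀ → to f x ≡ x [ j ]≔ to p (lookup x j)

    rotation-rotates : rotation ∈ Rotates
    rotation-rotates x ≢c₀ with removeAt x j ≟ᵥ c₀
    ... | yes eq = contradiction eq ≢c₀
    ... | no  _  = refl

    module _ {I : Set} (g : I → Vec A (suc m) ↔ Vec A (suc m)) where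
      open V.Criterion g using (_⇝_; ⇝-reflexive; ⇝-sym; ⇝-trans)

      -- Since `p` is transitive, every point of a rotated line can be driven to the one with value
      -- `z`; two such paths are joined there.
      line-connected : ∀ i → g i ∈ Rotates → ∀ x a → removeAt x j ≢ c₀ → x ⇝ x [ j ]≔ a
      line-connected i rot x a ≢c₀ =
        subst (_⇝ x [ j ]≔ a) ([]≔-lookup x j)
          (⇝-trans (to-zero (lookup x j)) (⇝-sym (to-zero a)))
        where
        to-zero : ∀ b → x [ j ]≔ b ⇝ x [ j ]≔ z
        to-zero = p-induction _
          (λ b → ⇝-trans (g i , gen i ,
            trans (rot (x [ j ]≔ b) (≢c₀ ∘ trans (sym (removeAt-update x j b))))
              (trans ([]≔-idempotent x j) (cong (λ d → x [ j ]≔ to p d) (lookup∘update j x b)))))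
          (⇝-reflexive refl)

  -- The first register belongs to the context of every later one, so a nonzero value there keeps a
  -- line away from the lines through the zero vector.
  removeAt≢zeros₁ : ∀ {a} → a ≢ z → ∀ {m} (t : Vec A (suc m)) i → removeAt (a ∷ t) (suc i) ≢ zeros (suc m)
  removeAt≢zeros₁ a≢z (_ ∷ _) i = a≢z ∘ ∷-injectiveˡ

  removeAt≢zeros₂ : ∀ {a b} → a ≢ z ⊎ b ≢ z → ∀ {m} (t : Vec A m) i →
    removeAt (a ∷ b ∷ t) (suc (suc i)) ≢ zeros (suc m)
  removeAt≢zeros₂ ≢z (_ ∷ _) i eq =
    [ (λ a≢z → a≢z (∷-injectiveˡ eq)) , (λ b≢z → b≢z (∷-injectiveˡ (∷-injectiveʳ eq))) ]′ ≢z

  -- Two values and at least three registers.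

  module Binary {one : A} (z≢one : z ≢ one) (two-valued : ∀ a → a ≡ z ⊎ a ≡ one)
    (pz≡one : to p z ≡ one) (m : ℕ) where

    X = Vec A (suc (suc (suc m)))
    u v u′ : X
    u  = zeros _
    v  = one ∷ zeros _
    u′ = z ∷ one ∷ zeros _

    g : Fin (suc (suc (suc m))) → X ↔ X
    g zero          = V.swap u v
    g (suc zero)    = rotation (suc zero) (one ∷ zeros _)
    g (suc (suc i)) = rotation (suc (suc i)) (zeros _)

    g-instruction : ∀ i → IsInstruction (g i)
    g-instruction zero          = zero , swap-trivial u zero z one
    g-instruction (suc zero)    = suc zero , rotation-trivial (suc zero) (one ∷ zeros _)
    g-instruction (suc (suc i)) = suc (suc i) , rotation-trivial (suc (suc i)) (zeros _)

    open V.Criterion g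

    one≢z : one ≢ z
    one≢z = ≢-sym z≢one

    u≢v : u ≢ v
    u≢v = z≢one ∘ ∷-injectiveˡ

    u′≢u : u′ ≢ u
    u′≢u = one≢z ∘ ∷-injectiveˡ ∘ ∷-injectiveʳ

    v≢u′ : v ≢ u′
    v≢u′ = one≢z ∘ ∷-injectiveˡ

    context≢ : ∀ {k} {t : Vec A k} → z ∷ t ≢ one ∷ zeros k
    context≢ = z≢one ∘ ∷-injectiveˡ

    gu≡u′ : to (g (suc zero)) u ≡ u′
    gu≡u′ = trans (rotation-rotates (suc zero) (one ∷ zeros _) u context≢)
      (cong (λ a → z ∷ a ∷ zeros _) pz≡one)

    gv≡v : to (g (suc zero)) v ≡ v
    gv≡v = rotation-fixes (suc zero) (one ∷ zeros _) v refl

    Tuvu′ : T u v u′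
    Tuvu′ = mkT u≢v v≢u′ u′≢u (V.cycle₃ u v u′) (mul (gen zero) swap∈)
      (V.cycle₃-1 u≢v u′≢u) (V.cycle₃-2 v≢u′ u′≢u) (V.cycle₃-3 u v u′) (λ _ → V.cycle₃-other)
      where
      swap∈ : V.swap v u′ ∈ 𝓖
      -- The second generator sends `u` to `u′` and fixes `v`, so it conjugates `swap u v` to
      -- `swap u′ v`.
      swap∈ = resp (λ x → trans (V.conjugate-swap (g (suc zero)) u v x)
          (trans (cong₂ (λ a b → V.swapFun a b x) gu≡u′ gv≡v) (V.swap-comm (≢-sym v≢u′) x)))
        (mul (gen (suc zero)) (mul (gen zero) (inv (gen (suc zero)))))

    stable : ∀ i → ∃[ a ] (a ~ u × to (g i) a ~ u)
    stable zero = v , ~-sym (inj₂ (_ , Tuvu′)) , inj₁ (V.swapFun-right u v)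
    stable (suc zero) = v , ~-sym (inj₂ (_ , Tuvu′)) ,
      subst (_~ u) (sym gv≡v) (~-sym (inj₂ (_ , Tuvu′)))
    stable (suc (suc i)) = u , inj₁ refl ,
      inj₁ (rotation-fixes (suc (suc i)) (zeros _) u (removeAt-replicate _ (suc (suc i)) z))

    tails-connected : ∀ {a b} → a ≢ z ⊎ b ≢ z → ∀ t s → a ∷ b ∷ t ⇝ a ∷ b ∷ s
    tails-connected ≢z = updates-connect _ (⇝-reflexive refl) ⇝-trans
      λ t i a → line-connected (suc (suc i)) (zeros _) g (suc (suc i))
        (rotation-rotates (suc (suc i)) (zeros _)) _ a (removeAt≢zeros₂ ≢z t i)

    second-register : ∀ {a b t} c → a ∷ t ≢ one ∷ zeros _ → a ∷ b ∷ t ⇝ a ∷ c ∷ t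
    second-register c ≢ = line-connected (suc zero) (one ∷ zeros _) g (suc zero)
        (rotation-rotates (suc zero) (one ∷ zeros _)) _ c ≢

    from-10 : ∀ t → one ∷ z ∷ t ⇝ u
    from-10 t = ⇝-trans (tails-connected (inj₁ one≢z) t (zeros _)) (g zero , gen zero , V.swapFun-right u v)

    from-01 : ∀ t → z ∷ one ∷ t ⇝ u
    from-01 t = ⇝-trans (tails-connected (inj₂ one≢z) t (zeros _)) (second-register z context≢)

    from-11 : ∀ t → one ∷ one ∷ t ⇝ u
    -- With an all-zero tail the second register could not be changed, as that is the fixed line
    -- through `v`. Setting the third register to `one` first leaves this line.
    from-11 t = ⇝-trans (tails-connected (inj₁ one≢z) t (one ∷ zeros _))
      (⇝-trans (second-register z (one≢z ∘ ∷-injectiveˡ ∘ ∷-injectiveʳ)) (from-10 _))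

    from-00 : ∀ t → z ∷ z ∷ t ⇝ u
    from-00 t = ⇝-trans (second-register one context≢) (from-01 t)

    connected : ∀ x → x ⇝ u
    connected (a ∷ b ∷ t) with two-valued a | two-valued b
    ... | inj₁ refl | inj₁ refl = from-00 t
    ... | inj₁ refl | inj₂ refl = from-01 t
    ... | inj₂ refl | inj₁ refl = from-10 t
    ... | inj₂ refl | inj₂ refl = from-11 t

    generates : ∀ f → f ∈ 𝓖
    generates = all⊆ stable (⇝-sym ∘ connected) parityᵥ (gen zero)
      (transposition-odd {t = g zero} (V.swap-transposition u≢v))

  -- At least three values.

  module Ternary {one two : A} (z≢one : z ≢ one) (z≢two : z ≢ two) (one≢two : one ≢ two) where

    -- On the exceptional line only the zero vector must stay fixed, which leaves room to exchange
    -- two other points there. The parity `P` is a parameter, so both parts of the theorem share the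
    -- construction.
    record Mover {m : ℕ} (j : Fin (suc m)) (P : Pred (Vec A (suc m) ↔ Vec A (suc m)) 0ℓ) : Set where
      field
        perm    : Vec A (suc m) ↔ Vec A (suc m)
        trivial : perm ∈ TrivialExcept j
        fixes   : to perm (zeros (suc m)) ≡ zeros (suc m)
        rotates : perm ∈ Rotates j (zeros m)
        parity  : perm ∈ P

    module _ {m : ℕ} (j : Fin (suc m)) where
      open Group (Sym (Vec A (suc m))) using (_∙_)

      private
        o = zeros (suc m)
        f = rotation j (zeros m)
        e₁ = o [ j ]≔ one
        e₂ = o [ j ]≔ two
        τ = V.swap e₁ e₂

        e-injective : ∀ {a b} → o [ j ]≔ a ≡ o [ j ]≔ b → a ≡ b
        e-injective {a} {b} eq = trans (sym (lookup∘update j o a))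
          (trans (cong (λ x → lookup x j) eq) (lookup∘update j o b))

        o≡ : o ≡ o [ j ]≔ z
        o≡ = sym (trans (cong (o [ j ]≔_) (sym (lookup-replicate j z))) ([]≔-lookup o j))

        f-fixes : to f o ≡ o
        f-fixes = rotation-fixes j (zeros m) o (removeAt-replicate m j z)

        e-context : ∀ a → removeAt (o [ j ]≔ a) j ≡ zeros m
        e-context a = trans (removeAt-update o j a) (removeAt-replicate m j z)

        τ∙f-trivial : τ ∙ f ∈ TrivialExcept j
        τ∙f-trivial i i≢j x = trans (swap-trivial o j one two i i≢j (to f x))
          (rotation-trivial j (zeros m) i i≢j x)

        τ∙f-fixes : to τ (to f o) ≡ o
        τ∙f-fixes = trans (cong (to τ) f-fixes) (V.swapFun-other
          (λ eq → z≢one (e-injective (trans (sym o≡) eq)))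
          (λ eq → z≢two (e-injective (trans (sym o≡) eq))))

        τ∙f-rotates : τ ∙ f ∈ Rotates j (zeros m)
        -- The rotated point stays on its own line, whose context is nonzero, and so differs from
        -- `e₁` and `e₂`.
        τ∙f-rotates x ≢0 = trans (cong (to τ) (rotation-rotates j (zeros m) x ≢0))
          (V.swapFun-other (off one) (off two))
          where
          off : ∀ b {a} → x [ j ]≔ a ≢ o [ j ]≔ b
          off b {a} eq = ≢0 (trans (sym (removeAt-update x j a))
            (trans (cong (λ y → removeAt y j) eq) (e-context b)))

        τ-odd : τ ∈ IsOdd
        τ-odd = transposition-odd {t = τ} (V.swap-transposition (one≢two ∘ e-injective))

        plain : ∀ {P} → f ∈ P → Mover j P
        plain f∈P = record { perm = f ; trivial = rotation-trivial j (zeros m) ; fixes = f-fixes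
          ; rotates = rotation-rotates j (zeros m) ; parity = f∈P }

        twisted : ∀ {P} → τ ∙ f ∈ P → Mover j P
        twisted τf∈P = record { perm = τ ∙ f ; trivial = τ∙f-trivial ; fixes = τ∙f-fixes
          ; rotates = τ∙f-rotates ; parity = τf∈P }

      -- If the rotation is odd, composing it with the transposition `τ` on the exceptional line
      -- corrects the parity.
      even-mover : Mover j IsEven
      even-mover with parityᵥ f
      ... | inj₁ ev = plain ev
      ... | inj₂ od = twisted (odd∙odd {f = τ} {f} τ-odd od)

      odd-mover : Mover j IsOdd
      odd-mover with parityᵥ f
      ... | inj₁ ev = twisted (odd∙even {f = τ} {f} τ-odd ev)
      ... | inj₂ od = plain od

    one≢z = ≢-sym z≢one
    two≢z = ≢-sym z≢two
    two≢one = ≢-sym one≢two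

    record Extra (c : A) : Set where
      constructor extra
      field
        ≢z   : c ≢ z
        ≢one : c ≢ one
        ≢two : c ≢ two

    -- The 4-cycle z ↦ two ↦ one ↦ c ↦ z, a square root of (z one)(two c).
    cycle₄ : A → A ↔ A
    cycle₄ c = Group._∙_ (Sym A) (A.swap z two) (A.cycle₃ two one c)

    module _ {c : A} (c-extra : Extra c) where
      open Extra c-extra

      private
        q = to (cycle₄ c)
        s = A.swapFun z two

        q-z : q z ≡ two
        q-z = trans (cong s (A.cycle₃-other z≢two z≢one (≢-sym ≢z))) (A.swapFun-left z two)

        q-two : q two ≡ one
        q-two = trans (cong s (A.cycle₃-1 two≢one ≢two)) (A.swapFun-other one≢z one≢two)

        q-one : q one ≡ c
        q-one = trans (cong s (A.cycle₃-2 (≢-sym ≢one) ≢two)) (A.swapFun-other ≢z ≢two)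

        q-c : q c ≡ z
        q-c = trans (cong s (A.cycle₃-3 two one c)) (A.swapFun-right z two)

        q-other : ∀ {a} → a ≢ z → a ≢ one → a ≢ two → a ≢ c → q a ≡ a
        q-other a≢z a≢1 a≢2 a≢c =
          trans (cong s (A.cycle₃-other a≢2 a≢1 a≢c)) (A.swapFun-other a≢z a≢2)

      square-z : q (q z) ≡ one
      square-z = trans (cong q q-z) q-two

      square-two : q (q two) ≡ c
      square-two = trans (cong q q-two) q-one

      square-involutive : ∀ a → q (q (q (q a))) ≡ a
      square-involutive a = check (a ≟ z) (a ≟ one) (a ≟ two) (a ≟ c)
        where
        square-one : q (q one) ≡ z
        square-one = trans (cong q q-one) q-c
        square-c : q (q c) ≡ two
        square-c = trans (cong q q-c) q-z
        check : Dec (a ≡ z) → Dec (a ≡ one) → Dec (a ≡ two) → Dec (a ≡ c) → q (q (q (q a))) ≡ a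
        check (yes refl) _ _ _ = trans (cong (q ∘ q) square-z) square-one
        check _ (yes refl) _ _ = trans (cong (q ∘ q) square-one) square-z
        check _ _ (yes refl) _ = trans (cong (q ∘ q) square-two) square-c
        check _ _ _ (yes refl) = trans (cong (q ∘ q) square-c) square-two
        check (no a≢z) (no a≢1) (no a≢2) (no a≢c) = trans (cong (q ∘ q) square-a) square-a
          where
          square-a : q (q a) ≡ a
          square-a = trans (cong q (q-other a≢z a≢1 a≢2 a≢c)) (q-other a≢z a≢1 a≢2 a≢c)

    -- Square roots for the first generator, one for each value of the second register. A 3-cycle is
    -- the square of its inverse. For `one` and `two` the required transposition is no square; the
    -- identity is used and `τ` supplies it.
    root : A → A ↔ A
    root c with c ≟ z | c ≟ one | c ≟ two
    ... | yes _ | _     | _     = A.cycle₃ z two one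
    ... | no _  | yes _ | _     = Group.ε (Sym A)
    ... | no _  | no _  | yes _ = Group.ε (Sym A)
    ... | no _  | no _  | no _  = cycle₄ c

    root-z : root z ≡ A.cycle₃ z two one
    root-z with z ≟ z
    ... | yes _ = refl
    ... | no ¬p = contradiction refl ¬p

    root-one : root one ≡ Group.ε (Sym A)
    root-one with one ≟ z | one ≟ one
    ... | yes eq | _     = contradiction eq one≢z
    ... | no _   | yes _ = refl
    ... | no _   | no ¬p = contradiction refl ¬p

    root-two : root two ≡ Group.ε (Sym A)
    root-two with two ≟ z | two ≟ one | two ≟ two
    ... | yes eq | _      | _     = contradiction eq two≢z
    ... | no _   | yes eq | _     = contradiction eq two≢one
    ... | no _   | no _   | yes _ = refl
    ... | no _   | no _   | no ¬p = contradiction refl ¬p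

    root-extra : ∀ {c} → Extra c → root c ≡ cycle₄ c
    root-extra {c} (extra ≢z ≢one ≢two) with c ≟ z | c ≟ one | c ≟ two
    ... | yes eq | _      | _      = contradiction eq ≢z
    ... | no _   | yes eq | _      = contradiction eq ≢one
    ... | no _   | no _   | yes eq = contradiction eq ≢two
    ... | no _   | no _   | no _   = refl

    data Kind : A → Set where
      is-z     : Kind z
      is-one   : Kind one
      is-two   : Kind two
      is-extra : ∀ {c} → Extra c → Kind c

    kind : ∀ c → Kind c
    kind c with c ≟ z | c ≟ one | c ≟ two
    ... | yes refl | _        | _        = is-z
    ... | no _     | yes refl | _        = is-one
    ... | no _     | no _     | yes refl = is-two
    ... | no ≢z    | no ≢one  | no ≢two  = is-extra (extra ≢z ≢one ≢two)

    module _ (m : ℕ) where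

      X = Vec A (suc (suc m))
      open Group (Sym X) using (_∙_)

      pt : A → A → X
      pt a c = a ∷ c ∷ zeros m

      pt-injective₁ : ∀ {a b c d} → pt a c ≡ pt b d → a ≡ b
      pt-injective₁ = ∷-injectiveˡ

      pt-injective₂ : ∀ {a b c d} → pt a c ≡ pt b d → c ≡ d
      pt-injective₂ = ∷-injectiveˡ ∘ ∷-injectiveʳ

      off-plane : ∀ {a b c d t} → t ≢ zeros m → a ∷ c ∷ t ≢ pt b d
      off-plane t≢0 = t≢0 ∘ ∷-injectiveʳ ∘ ∷-injectiveʳ

      plane : (A → A ↔ A) → Vec A (suc m) → A ↔ A
      plane θ (c ∷ t) with t ≟ᵥ zeros m
      ... | yes _ = θ c
      ... | no  _ = Group.ε (Sym A)

      τ : A → X ↔ X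
      τ c = V.swap (pt z c) (pt one c)

      ρ : X ↔ X
      ρ = instruction zero (plane root)

      -- Two transpositions and a square, so that evenness needs no counting of cycles.
      g₁ : X ↔ X
      g₁ = τ one ∙ (τ two ∙ (ρ ∙ ρ))

      ρ-plane : ∀ a c → to ρ (pt a c) ≡ pt (to (root c) a) c
      ρ-plane a c with zeros m ≟ᵥ zeros m
      ... | yes _ = refl
      ... | no ¬p = contradiction refl ¬p

      ρ-off : ∀ a c {t} → t ≢ zeros m → to ρ (a ∷ c ∷ t) ≡ a ∷ c ∷ t
      ρ-off a c {t} t≢0 with t ≟ᵥ zeros m
      ... | yes eq = contradiction eq t≢0
      ... | no  _  = refl

      τ-same : ∀ a c → to (τ c) (pt a c) ≡ pt (A.swapFun z one a) c
      τ-same a c = swapFun-natural _≟_ _≟ᵥ_ (λ a → pt a c) pt-injective₁ z one a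

      τ-different : ∀ {c d} a → c ≢ d → to (τ d) (pt a c) ≡ pt a c
      τ-different a c≢d = V.swapFun-other (c≢d ∘ pt-injective₂) (c≢d ∘ pt-injective₂)

      τ-off : ∀ d a c {t} → t ≢ zeros m → to (τ d) (a ∷ c ∷ t) ≡ a ∷ c ∷ t
      τ-off d a c t≢0 = V.swapFun-other (off-plane t≢0) (off-plane t≢0)

      ρ²-plane : ∀ a {c σ} → root c ≡ σ → to ρ (to ρ (pt a c)) ≡ pt (to σ (to σ a)) c
      ρ²-plane a {c} refl = trans (cong (to ρ) (ρ-plane a c)) (ρ-plane (to (root c) a) c)

      g₁-off : ∀ a c {t} → t ≢ zeros m → to g₁ (a ∷ c ∷ t) ≡ a ∷ c ∷ t
      g₁-off a c t≢0 = trans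
        (cong (to (τ one) ∘ to (τ two)) (trans (cong (to ρ) (ρ-off a c t≢0)) (ρ-off a c t≢0)))
        (trans (cong (to (τ one)) (τ-off two a c t≢0)) (τ-off one a c t≢0))

      g₁-plain : ∀ a {c σ} → c ≢ one → c ≢ two → root c ≡ σ → to g₁ (pt a c) ≡ pt (to σ (to σ a)) c
      g₁-plain a c≢one c≢two eq = trans (cong (to (τ one) ∘ to (τ two)) (ρ²-plane a eq))
        (trans (cong (to (τ one)) (τ-different _ c≢two)) (τ-different _ c≢one))

      g₁-one : ∀ a → to g₁ (pt a one) ≡ pt (A.swapFun z one a) one
      g₁-one a = trans (cong (to (τ one) ∘ to (τ two)) (ρ²-plane a root-one))
        (trans (cong (to (τ one)) (τ-different a one≢two)) (τ-same a one))

      g₁-two : ∀ a → to g₁ (pt a two) ≡ pt (A.swapFun z one a) two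
      g₁-two a = trans (cong (to (τ one) ∘ to (τ two)) (ρ²-plane a root-two))
        (trans (cong (to (τ one)) (τ-same a two)) (τ-different _ two≢one))

      g₁-z : ∀ a → to g₁ (pt a z) ≡ pt (to (A.cycle₃ z two one) (to (A.cycle₃ z two one) a)) z
      g₁-z a = g₁-plain a z≢one z≢two root-z

      g₁-extra : ∀ a {c} → Extra c → to g₁ (pt a c) ≡ pt (to (cycle₄ c) (to (cycle₄ c) a)) c
      g₁-extra a e@(extra _ ≢one ≢two) = g₁-plain a ≢one ≢two (root-extra e)

      g₁-trivial : g₁ ∈ TrivialExcept zero
      g₁-trivial i i≢0 x = trans (swap-trivial (pt z one) zero z one i i≢0 (to (τ two) (to ρ (to ρ x))))
        (trans (swap-trivial (pt z two) zero z one i i≢0 (to ρ (to ρ x)))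
          (trans (instruction-trivial zero (plane root) i i≢0 (to ρ x))
            (instruction-trivial zero (plane root) i i≢0 x)))

      g₁-even : g₁ ∈ IsEven
      g₁-even = even-resp {f = (τ one ∙ τ two) ∙ (ρ ∙ ρ)} {g₁} (λ _ → refl)
        (even∙even {f = τ one ∙ τ two} {ρ ∙ ρ}
          (odd∙odd {f = τ one} {τ two} (τ-odd one) (τ-odd two))
          (V.square-even (vectors L _) (vectors-complete complete) ρ))
        where
        τ-odd : ∀ c → τ c ∈ IsOdd
        τ-odd c = transposition-odd {t = τ c} (V.swap-transposition (z≢one ∘ pt-injective₁))

      private
        κ = to (A.cycle₃ z two one)

        κ-z : κ z ≡ two
        κ-z = A.cycle₃-1 z≢two one≢z
        κ-two : κ two ≡ one
        κ-two = A.cycle₃-2 two≢one one≢z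
        κ-one : κ one ≡ z
        κ-one = A.cycle₃-3 z two one

      g₁-u : to g₁ (pt z z) ≡ pt one z
      g₁-u = trans (g₁-z z) (cong (λ a → pt a z) (trans (cong κ κ-z) κ-two))

      g₁-v : to g₁ (pt one z) ≡ pt two z
      g₁-v = trans (g₁-z one) (cong (λ a → pt a z) (trans (cong κ κ-one) κ-z))

      g₁-w : to g₁ (pt two z) ≡ pt z z
      g₁-w = trans (g₁-z two) (cong (λ a → pt a z) (trans (cong κ κ-two) κ-one))

      -- Where the second register is `z`, `g₁` is a 3-cycle on the first; for each other value it
      -- is an involution, which squaring removes.
      g₁²-fixes-plane : ∀ {a c} → Kind c → pt a c ≢ pt z z → pt a c ≢ pt two z → pt a c ≢ pt one z →
        to g₁ (to g₁ (pt a c)) ≡ pt a c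
      g₁²-fixes-plane {a} is-z ≢u ≢w ≢v = trans (cong (to g₁) fixed) fixed
        where
        κa≡a : κ a ≡ a
        κa≡a = A.cycle₃-other (λ { refl → ≢u refl }) (λ { refl → ≢w refl }) (λ { refl → ≢v refl })
        fixed : to g₁ (pt a z) ≡ pt a z
        fixed = trans (g₁-z a) (cong (λ b → pt b z) (trans (cong κ κa≡a) κa≡a))
      g₁²-fixes-plane {a} is-one _ _ _ = trans (cong (to g₁) (g₁-one a))
        (trans (g₁-one _) (cong (λ b → pt b one) (A.swapFun-involutive z one a)))
      g₁²-fixes-plane {a} is-two _ _ _ = trans (cong (to g₁) (g₁-two a))
        (trans (g₁-two _) (cong (λ b → pt b two) (A.swapFun-involutive z one a)))
      g₁²-fixes-plane {a} {c} (is-extra e) _ _ _ = trans (cong (to g₁) (g₁-extra a e))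
        (trans (g₁-extra _ e) (cong (λ b → pt b c) (square-involutive e a)))

      g₁²-fixes : ∀ x → x ≢ pt z z → x ≢ pt two z → x ≢ pt one z → to g₁ (to g₁ x) ≡ x
      g₁²-fixes (a ∷ c ∷ t) = split (t ≟ᵥ zeros m)
        where
        split : ∀ {t} → Dec (t ≡ zeros m) → a ∷ c ∷ t ≢ pt z z → a ∷ c ∷ t ≢ pt two z →
          a ∷ c ∷ t ≢ pt one z → to g₁ (to g₁ (a ∷ c ∷ t)) ≡ a ∷ c ∷ t
        split (yes refl) = g₁²-fixes-plane (kind c)
        split (no t≢0) _ _ _ = trans (cong (to g₁) (g₁-off a c t≢0)) (g₁-off a c t≢0)

      -- Generation with at least three values.

      module Generators {P : Fin (suc m) → Pred (X ↔ X) 0ℓ} (M : ∀ i → Mover (suc i) (P i)) where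

        g : Fin (suc (suc m)) → X ↔ X
        g zero    = g₁
        g (suc i) = Mover.perm (M i)

        g-instruction : ∀ i → IsInstruction (g i)
        g-instruction zero    = zero , g₁-trivial
        g-instruction (suc i) = suc i , Mover.trivial (M i)

        open V.Criterion g

        -- `g₁` runs through the first-register values `z`, `one`, `two` in this order, so its
        -- square runs through them as `z`, `two`, `one`.
        Tuwv : T (pt z z) (pt two z) (pt one z)
        Tuwv = mkT (z≢two ∘ pt-injective₁) (two≢one ∘ pt-injective₁) (one≢z ∘ pt-injective₁)
          (g₁ ∙ g₁) (mul (gen zero) (gen zero))
          (trans (cong (to g₁) g₁-u) g₁-v) (trans (cong (to g₁) g₁-w) g₁-u)
          (trans (cong (to g₁) g₁-v) g₁-w) g₁²-fixes

        stable : ∀ i → ∃[ a ] (a ~ pt z z × to (g i) a ~ pt z z)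
        stable zero    = pt two z , ~-sym (inj₂ (_ , Tuwv)) , inj₁ g₁-w
        stable (suc i) = pt z z , inj₁ refl , inj₁ (Mover.fixes (M i))

        step : ∀ {x y} → to g₁ x ≡ y → x ⇝ y
        step eq = g₁ , gen zero , eq

        line : ∀ i x a → removeAt x (suc i) ≢ zeros _ → x ⇝ x [ suc i ]≔ a
        line i = line-connected (suc i) (zeros _) g (suc i) (Mover.rotates (M i))

        column : ∀ {a} → a ≢ z → ∀ t s → a ∷ t ⇝ a ∷ s
        column a≢z = updates-connect _ (⇝-reflexive refl) ⇝-trans
          λ t i b → line i _ b (removeAt≢zeros₁ a≢z t i)

        tail : ∀ {a b} → a ≢ z ⊎ b ≢ z → ∀ t s → a ∷ b ∷ t ⇝ a ∷ b ∷ s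
        tail ≢z = updates-connect _ (⇝-reflexive refl) ⇝-trans
          λ t i b → line (suc i) _ b (removeAt≢zeros₂ ≢z t i)

        from-nonzero : ∀ {a} → a ≢ z → ∀ t → a ∷ t ⇝ pt z z
        from-nonzero {a} a≢z t = cases (kind a) a≢z
          where
          cases : ∀ {a} → Kind a → a ≢ z → a ∷ t ⇝ pt z z
          cases is-z   a≢z = contradiction refl a≢z
          cases is-two a≢z = ⇝-trans (column a≢z t (zeros _)) (step g₁-w)
          cases is-one a≢z = ⇝-trans (column a≢z t (zeros _)) (⇝-trans (step g₁-v) (step g₁-w))
          -- With second register `z`, `g₁` would fix this point. With second register `a` it
          -- exchanges the first-register values `two` and `a`, so a backward step gives `two`.
          cases {a} (is-extra e) a≢z = ⇝-trans (column a≢z t (a ∷ zeros m))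
            (⇝-trans (⇝-sym (step (trans (g₁-extra two e) (cong (λ b → pt b a) (square-two e)))))
              (⇝-trans (column two≢z _ (zeros _)) (step g₁-w)))

        -- For every `c` other than `z`, `g₁` sends the first register from `z` to `one`, where the
        -- other registers can be changed freely.
        from-plane : ∀ c → pt z c ⇝ pt z z
        from-plane c = cases (kind c)
          where
          via-one : ∀ {c} → to g₁ (pt z c) ≡ pt one c → pt z c ⇝ pt z z
          via-one eq = ⇝-trans (step eq) (from-nonzero one≢z _)
          cases : ∀ {c} → Kind c → pt z c ⇝ pt z z
          cases is-z   = ⇝-reflexive refl
          cases is-one = via-one (trans (g₁-one z) (cong (λ b → pt b one) (A.swapFun-left z one)))
          cases is-two = via-one (trans (g₁-two z) (cong (λ b → pt b two) (A.swapFun-left z one)))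
          cases {c} (is-extra e) = via-one (trans (g₁-extra z e) (cong (λ b → pt b c) (square-z e)))

        connected : ∀ x → x ⇝ pt z z
        connected (a ∷ c ∷ t) = cases (a ≟ z) (t ≟ᵥ zeros m)
          where
          cases : ∀ {a t} → Dec (a ≡ z) → Dec (t ≡ zeros m) → a ∷ c ∷ t ⇝ pt z z
          cases (no a≢z)   _          = from-nonzero a≢z _
          cases (yes refl) (yes refl) = from-plane c
          -- The nonzero tail permits setting the second register to `one`; that value in turn
          -- permits clearing the tail.
          cases {t = t} (yes refl) (no t≢0) = ⇝-trans (line zero (z ∷ c ∷ t) one (t≢0 ∘ ∷-injectiveʳ))
            (⇝-trans (tail (inj₂ one≢z) t (zeros m)) (from-plane one))

        even∈ : ∀ f → f ∈ IsEven → f ∈ 𝓖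
        even∈ = even⊆ stable (⇝-sym ∘ connected)

        all∈ : ∀ i → g i ∈ IsOdd → ∀ f → f ∈ 𝓖
        all∈ i = all⊆ stable (⇝-sym ∘ connected) parityᵥ (gen i)

-- A transitive cycle on a finite set, and the cases of the theorem.

cyclic : ∀ k → Fin (suc k) ↔ Fin (suc k)
cyclic k = mk↔ₛ′ down up down-up up-down
  where
  down : Fin (suc k) → Fin (suc k)
  down zero    = fromℕ k
  down (suc i) = inject₁ i
  up : Fin (suc k) → Fin (suc k)
  up i with view i
  ... | ‵fromℕ     = zero
  ... | ‵inject₁ j = suc j
  down-up : ∀ i → down (up i) ≡ i
  down-up i with view i
  ... | ‵fromℕ     = refl
  ... | ‵inject₁ _ = refl
  up-down : ∀ i → up (down i) ≡ i
  up-down zero    rewrite view-fromℕ k   = refl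
  up-down (suc i) rewrite view-inject₁ i = refl

cyclic-induction : ∀ {k} (P : Fin (suc k) → Set) → (∀ i → P (to (cyclic k) i) → P i) → P zero →
  ∀ i → P i
cyclic-induction P step base zero    = base
cyclic-induction {suc k} P step base (suc i) = step (suc i)
  -- The shorter cycle wraps `zero` to its own top element, unlike the longer one, so at `zero` the
  -- induction step is answered by `base`.
  (cyclic-induction (P ∘ inject₁) (λ { zero _ → base ; (suc j) pj → step (suc (inject₁ j)) pj }) base i)

module _ {A : Set} {q : ℕ} (e : A ↔ Fin q) where

  element-≟ : DecidableEquality A
  element-≟ = via-injection (Inverse⇒Injection e) _≟ᶠ_

  elements : List A
  elements = map (from e) (allFin q)

  elements-complete : ∀ a → a ∈ₗ elements
  elements-complete a = subst (_∈ₗ elements) (strictlyInverseʳ e a) (∈-map⁺ (from e) (∈-allFin (to e a)))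

  from-≢ : ∀ {i j} → i ≢ j → from e i ≢ from e j
  from-≢ i≢j = i≢j ∘ to-injective (↔-sym e)

theorem1 : (A : Set) (q n : ℕ) → A ↔ Fin q → 2 ≤ q → 2 ≤ n →
    (¬ (q ≡ 2 × n ≡ 2) →
    ∃[ g ] ((∀ (i : Fin n) → IsInstruction (g i)) × Generates (Sym (Vec A n)) g U))
    × (3 ≤ q →
    ∃[ g ] ((∀ (i : Fin n) → IsInstruction (g i)) × (∀ i → IsEven (g i)) × Generates (Sym (Vec A n)) g (Alt (Vec A n))))
theorem1 A 1 n e (s≤s ()) 2≤n
theorem1 A q 1 e 2≤q (s≤s ())
theorem1 A 2 2 e _ _ = (λ ≢2 → contradiction (refl , refl) ≢2) , λ { (s≤s (s≤s ())) }
theorem1 A 2 (suc (suc (suc m))) e _ _ =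
  (λ _ → B.g , B.g-instruction , λ f → mk⇔ (λ _ → tt) (λ _ → B.generates f)) , λ { (s≤s (s≤s ())) }
  where
  zero′ one : A
  zero′ = from e zero
  one   = from e (suc zero)
  two-valued : ∀ a → a ≡ zero′ ⊎ a ≡ one
  two-valued a with to e a in eq
  ... | zero     = inj₁ (sym (from-unique e eq))
  ... | suc zero = inj₂ (sym (from-unique e eq))
  open Swap (element-≟ e)
  flip-induction : (P : A → Set) → (∀ a → P (swapFun zero′ one a) → P a) → P zero′ → ∀ a → P a
  flip-induction P step base a with two-valued a
  ... | inj₁ refl = base
  ... | inj₂ refl = step one (subst P (sym (swapFun-right zero′ one)) base)
  module R = Registers (element-≟ e) (elements e) (elements-complete e) zero′ (swap zero′ one) flip-induction
  module B = R.Binary (from-≢ e λ ()) two-valued (swapFun-left zero′ one) m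
theorem1 A (suc (suc (suc k))) (suc (suc m)) e _ _ =
  (λ _ → O.g , O.g-instruction ,
    -- One odd generator suffices; the one for the second register exists because there are at least
    -- two registers.
    λ f → mk⇔ (λ _ → tt) (λ _ → O.all∈ (suc zero) (T.Mover.parity (T.odd-mover (suc zero))) f)) ,
  (λ _ → E.g , E.g-instruction , even ,
    λ f → mk⇔ (Parity.span-even even) (E.even∈ f))
  where
  p : A ↔ A
  -- The cycle of length `q`, transported from `Fin q` to `A`.
  p = ↔-sym e ↔-∘ (cyclic (suc (suc k)) ↔-∘ e)
  p-induction : (P : A → Set) → (∀ a → P (to p a) → P a) → P (from e zero) → ∀ a → P a
  p-induction P step base a = subst P (strictlyInverseʳ e a)
    (cyclic-induction (P ∘ from e)
      (λ i Pi → step (from e i) (subst (P ∘ from e ∘ to (cyclic _)) (sym (strictlyInverseˡ e i)) Pi))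
      base (to e a))
  module R = Registers (element-≟ e) (elements e) (elements-complete e) (from e zero) p p-induction
  module T = R.Ternary {from e (suc zero)} {from e (suc (suc zero))}
    (from-≢ e λ ()) (from-≢ e λ ()) (from-≢ e λ ())
  module O = T.Generators m (T.odd-mover ∘ suc)
  module E = T.Generators m (T.even-mover ∘ suc)
  even : ∀ i → IsEven (E.g i)
  even zero    = T.g₁-even m
  even (suc i) = T.Mover.parity (T.even-mover (suc i))
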